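{- Let $\Delta\ge 6$ and let $n=k\Delta+1+j$, where $k\geq\Delta-1$ and $1\leq j\leq\Delta-1$ are integers. Then the family $\mathcal{T}''_{n,\Delta}$ is not empty and all trees in $\mathcal{T}''_{n,\Delta}$ have the same value of $\sigma$-irregularity.
   Context: For a graph $G$, $\sigma(G)=\sum_{uv\in E(G)}(d(u)-d(v))^2$, where $d(u)$ is the degree of $u$. For a tree $T$, $m_{ij}=m_{ji}$ is the number of edges whose end-vertices have degrees $i$ and $j$. An internal leaf of a tree is a vertex of degree at least $2$ having precisely one neighbor of degree greater than $1$. The family $\mathcal{T}''_{n,\Delta}$ consists of all trees $T$ on $n$ vertices with maximum degree $\Delta$ such that: (1) all internal leaves of $T$ have degree $\Delta$; (2) all vertices of $T$ have degree in $\{1,2,\Delta\}$; (3) $m_{22}=0$ and $m_{\Delta\Delta}\le\Delta-1$. -}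

module Defs where

open import Data.Fin.Base using (Fin)
import Data.Fin.Properties as Fin
open import Data.List.Base using (List; []; _∷_; [_]; _++_; length; map; filter; allFin; cartesianProduct)
open import Data.List.Extrema.Nat using (max)
open import Data.List.Relation.Unary.Linked using (Linked)
open import Data.List.Relation.Unary.Unique.Propositional using (Unique)
open import Data.Nat.Base using (ℕ; NonZero; _≤_; _<_; _∸_; _^_; ∣_-_∣)
open import Data.Nat.ListAction using (sum)
open import Data.Nat.Properties using (_≟_)
open import Data.Product using (∃!; _×_; _,_)
open import Data.Sum.Base using (_⊎_)
open import Level using (0ℓ)
open import Relation.Binary.Construct.Closure.ReflexiveTransitive using (Star)
open import Relation.Binary.Core using (Rel)
open import Relation.Binary.Definitions using (Decidable; Irreflexive; Symmetric)
open import Relation.Binary.PropositionalEquality using (_≡_)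
open import Relation.Nullary.Decidable using (_×-dec_; _⊎-dec_)
open import Relation.Nullary.Negation using (¬_)

record Graph (n : ℕ) : Set₁ where
  infix 4 _~_ _~?_
  field
    _~_      : Rel (Fin n) 0ℓ
    _~?_     : Decidable _~_
    ~-sym    : Symmetric _~_
    ~-irrefl : Irreflexive _≡_ _~_

  degree : Fin n → ℕ
  degree u = length (filter (u ~?_) (allFin n))

  maxDegree : ℕ
  maxDegree = max 0 (map degree (allFin n))

  -- Each unordered edge uv is listed once, as the pair with u < v.
  edges : List (Fin n × Fin n)
  edges = filter (λ (u , v) → (u Fin.<? v) ×-dec (u ~? v))
                 (cartesianProduct (allFin n) (allFin n))

  -- In ℕ, ∣ a - b ∣ is the absolute difference, so its square is (a - b)².
  σ : ℕ
  σ = sum (map (λ (u , v) → ∣ degree u - degree v ∣ ^ 2) edges)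

  m : ℕ → ℕ → ℕ
  m i j = length (filter
    (λ (u , v) → ((degree u ≟ i) ×-dec (degree v ≟ j)) ⊎-dec
                 ((degree u ≟ j) ×-dec (degree v ≟ i)))
    edges)

  Connected : Set
  Connected = ∀ u v → Star _~_ u v

  -- A cycle is a closed walk v, vs, v whose at least three vertices v, vs are
  -- pairwise distinct.
  IsCycle : Fin n → List (Fin n) → Set
  IsCycle v vs = 2 ≤ length vs × Unique (v ∷ vs) × Linked _~_ (v ∷ vs ++ [ v ])

  Acyclic : Set
  Acyclic = ∀ v vs → ¬ IsCycle v vs

  InternalLeaf : Fin n → Set
  InternalLeaf v = 2 ≤ degree v × ∃! _≡_ (λ w → v ~ w × 1 < degree w)

  record IsTree : Set where
    field
      nonEmpty  : NonZero n
      connected : Connected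
      acyclic   : Acyclic

  record In𝒯″ (Δ : ℕ) : Set where
    field
      isTree                : IsTree
      maxDegree≡Δ           : maxDegree ≡ Δ
      internalLeaf-degree   : ∀ v → InternalLeaf v → degree v ≡ Δ
      degree∈[1,2,Δ]        : ∀ v → degree v ≡ 1 ⊎ degree v ≡ 2 ⊎ degree v ≡ Δ
      m₂₂≡0                 : m 2 2 ≡ 0
      mΔΔ≤Δ∸1               : m Δ Δ ≤ Δ ∸ 1

{-# OPTIONS --safe #-}

-- Count edges. A tree has n - 1 edges: rooting it, every other vertex has exactly one neighbour nearer
-- to the root, as two neighbours that are no farther would close a cycle. In a tree of the family every
-- edge has an end of degree Δ, so with N_i vertices of degree i we get N₁ + N₂ + N_Δ = n,
-- N₁ + 2 N₂ + Δ N_Δ = 2 (n - 1), Δ N_Δ = n - 1 + m_ΔΔ and σ = (Δ - 1)² N₁ + 2 (Δ - 2)² N₂.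
-- As m_ΔΔ < Δ, the third equation determines N_Δ, and then the others determine N₁, N₂ and σ.
-- For existence, string k + 1 vertices of degree Δ on a path, joining Δ - j consecutive pairs by an edge
-- and the others through a vertex of degree 2, and fill up with leaves.
module Submission where

open import Defs
open import Data.Nat.Base using (ℕ; _+_; _*_; _∸_; _≤_)
open import Data.Product using (∃; _×_)
open import Relation.Binary.PropositionalEquality using (_≡_)

import Algebra.Properties.Semiring.Sum
open import Data.Bool.Base using (if_then_else_; true; false)
open import Data.Empty using (⊥; ⊥-elim)
open import Data.Fin.Base using (Fin; zero; suc)
import Data.Fin.Base as Fin
import Data.Fin.Properties as Fin
open import Data.List.Base
  using (List; []; _∷_; [_]; _++_; length; map; filter; tabulate; allFin; cartesianProduct)
open import Data.List.Extrema.Nat using (max≤v⁺; xs≤max)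
import Data.List.Membership.DecPropositional as DecMembership
open import Data.List.Membership.Propositional.Properties
  using (∈-filter⁺; ∈-cartesianProduct⁺; ∈-allFin; ∈-length; ∈-map⁺)
open import Data.List.Properties using (map-++; map-∘)
open import Data.List.Relation.Unary.All as All using (All; []; _∷_)
import Data.List.Relation.Unary.All.Properties as All
open import Data.List.Relation.Unary.AllPairs using ([]; _∷_)
open import Data.List.Relation.Unary.Any as Any using (here; there)
open import Data.List.Relation.Unary.Linked using (Linked; [-]; _∷_)
open import Data.List.Relation.Unary.Unique.Propositional using (Unique)
open import Data.Nat.Base hiding (ℕ; _+_; _*_; _∸_; _≤_)
open import Data.Nat.Induction using (<-rec)
open import Data.Nat.ListAction using (sum)
open import Data.Nat.ListAction.Properties using (sum-++)
open import Data.Nat.Properties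
open import Data.Nat.Solver using (module +-*-Solver)
open import Data.Product using (_,_; proj₁; proj₂; uncurry; swap)
open import Data.Sum.Base as Sum using (_⊎_; inj₁; inj₂; [_,_]′)
open import Function.Base using (_∘_; id; case_of_)
open import Relation.Binary.Construct.Closure.ReflexiveTransitive using (Star; ε; _◅_; _◅◅_; reverse; gmap)
open import Relation.Binary.Definitions using (tri<; tri≈; tri>)
open import Relation.Binary.PropositionalEquality hiding ([_]; _≡_)
open import Relation.Nullary
open import Relation.Unary using (Pred; Decidable)
open +-*-Solver using (solve; _:+_; _:*_; _:=_; con)
open Algebra.Properties.Semiring.Sum +-*-semiring
  using (sum-cong-≗; ∑-distrib-+; ∑-comm; *-distribˡ-sum) renaming (sum to ∑)
open module ∈-Fin {n} = DecMembership (Fin._≟_ {n}) using (_∈?_; _∈_)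

private variable
  n : ℕ
  A : Set

-- Indicators and finite sums

𝟙 : Dec A → ℕ
𝟙 P? = if does P? then 1 else 0

𝟙-yes : (P? : Dec A) → A → 𝟙 P? ≡ 1
𝟙-yes (yes _) _ = refl
𝟙-yes (no ¬p) p = contradiction p ¬p

𝟙-no : (P? : Dec A) → ¬ A → 𝟙 P? ≡ 0
𝟙-no (yes p) ¬p = contradiction p ¬p
𝟙-no (no _)  _  = refl

𝟙-cong : {B : Set} (P? : Dec A) (Q? : Dec B) → (A → B) → (B → A) → 𝟙 P? ≡ 𝟙 Q?
𝟙-cong (yes p) Q? f _ = sym (𝟙-yes Q? (f p))
𝟙-cong (no ¬p) Q? _ g = sym (𝟙-no Q? (¬p ∘ g))

𝟙-×-* : {B : Set} (P? : Dec A) (Q? : Dec B) → ∀ k → 𝟙 (P? ×-dec Q?) * k ≡ 𝟙 P? * (𝟙 Q? * k)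
𝟙-×-* (yes _) (yes _) k = sym (+-identityʳ _)
𝟙-×-* (yes _) (no _)  k = refl
𝟙-×-* (no _)  _       k = refl

-- Inclusion-exclusion for an edge with at least one good end: it has one good end, and one more if
-- both are good. The repeated disjunct is the shape that `m i j` takes when `i` and `j` agree.
𝟙-both : {A B : Set} (P? : Dec A) (Q? : Dec B) → A ⊎ B →
         𝟙 ((P? ×-dec Q?) ⊎-dec (P? ×-dec Q?)) + 1 ≡ 𝟙 P? + 𝟙 Q?
𝟙-both (yes _) (yes _) _        = refl
𝟙-both (yes _) (no _)  _        = refl
𝟙-both (no _)  (yes _) _        = refl
𝟙-both (no ¬p) (no _)  (inj₁ p) = contradiction p ¬p
𝟙-both (no _)  (no ¬q) (inj₂ q) = contradiction q ¬q

𝟙-*-cong : (P? : Dec A) {k l : ℕ} → (A → k ≡ l) → 𝟙 P? * k ≡ 𝟙 P? * l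
𝟙-*-cong (yes p) k≡l = cong (1 *_) (k≡l p)
𝟙-*-cong (no _)  k≡l = refl

∑-mono : {f g : Fin n → ℕ} → (∀ i → f i ≤ g i) → ∑ f ≤ ∑ g
∑-mono {zero}  _   = z≤n
∑-mono {suc n} f≤g = +-mono-≤ (f≤g zero) (∑-mono (f≤g ∘ suc))

∑-zero : ∑ {n} (λ _ → 0) ≡ 0
∑-zero {zero}  = refl
∑-zero {suc n} = ∑-zero {n}

∑-one : ∑ {n} (λ _ → 1) ≡ n
∑-one {zero}  = refl
∑-one {suc n} = cong suc (∑-one {n})

∑-𝟙≟ : (i : Fin n) → ∑ (λ j → 𝟙 (j Fin.≟ i)) ≡ 1
∑-𝟙≟ {suc n} zero = cong suc (trans (sum-cong-≗ {n} λ j → 𝟙-no (suc j Fin.≟ zero) λ ()) (∑-zero {n}))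
∑-𝟙≟ {suc n} (suc i) = trans
  (sum-cong-≗ {n} λ j → 𝟙-cong (suc j Fin.≟ suc i) (j Fin.≟ i) Fin.suc-injective (cong suc))
  (∑-𝟙≟ i)

∑-𝟙-unique : {P : Fin n → Set} (P? : ∀ i → Dec (P i)) (i : Fin n) → P i → (∀ j → P j → j ≡ i) →
             ∑ (𝟙 ∘ P?) ≡ 1
∑-𝟙-unique P? i Pi unique =
  trans (sum-cong-≗ λ j → 𝟙-cong (P? j) (j Fin.≟ i) (unique j) λ { refl → Pi }) (∑-𝟙≟ i)

sum-map-tabulate : (g : A → ℕ) (f : Fin n → A) → sum (map g (tabulate f)) ≡ ∑ (g ∘ f)
sum-map-tabulate {n = zero}  g f = refl
sum-map-tabulate {n = suc n} g f = cong (g (f zero) +_) (sum-map-tabulate g (f ∘ suc))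

sum-map-filter : {P : Pred A _} (P? : Decidable P) (f : A → ℕ) (xs : List A) →
                 sum (map f (filter P? xs)) ≡ sum (map (λ x → 𝟙 (P? x) * f x) xs)
sum-map-filter P? f []       = refl
sum-map-filter P? f (x ∷ xs) with does (P? x)
... | true  = cong₂ _+_ (sym (+-identityʳ (f x))) (sum-map-filter P? f xs)
... | false = sum-map-filter P? f xs

length-filter : {P : Pred A _} (P? : Decidable P) (xs : List A) →
                length (filter P? xs) ≡ sum (map (𝟙 ∘ P?) xs)
length-filter P? []       = refl
length-filter P? (x ∷ xs) with does (P? x)
... | true  = cong suc (length-filter P? xs)
... | false = length-filter P? xs

sum-map-cartesianProduct : {B : Set} (f : A × B → ℕ) (xs : List A) (ys : List B) →
  sum (map f (cartesianProduct xs ys)) ≡ sum (map (λ x → sum (map (λ y → f (x , y)) ys)) xs)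
sum-map-cartesianProduct f []       ys = refl
sum-map-cartesianProduct f (x ∷ xs) ys = begin
  sum (map f (map (x ,_) ys ++ cartesianProduct xs ys))
    ≡⟨ cong sum (map-++ f (map (x ,_) ys) _) ⟩
  sum (map f (map (x ,_) ys) ++ map f (cartesianProduct xs ys))
    ≡⟨ sum-++ (map f (map (x ,_) ys)) _ ⟩
  sum (map f (map (x ,_) ys)) + sum (map f (cartesianProduct xs ys))
    ≡⟨ cong₂ _+_ (cong sum (sym (map-∘ ys))) (sum-map-cartesianProduct f xs ys) ⟩
  _ ∎
  where open ≡-Reasoning

-- `p` picks one of the two orders of every pair on which `g` does not vanish. Exchanging the
-- summation indices turns the part picked by `p v u` into the one picked by `p u v`. Serves with
-- edges oriented by index and, later, by height.
∑∑-symmetric : (p g : Fin n → Fin n → ℕ) → (∀ u v → g u v ≡ g v u) →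
  (∀ u v → g u v ≡ p u v * g u v + p v u * g u v) →
  ∑ (λ u → ∑ (g u)) ≡ 2 * ∑ (λ u → ∑ λ v → p u v * g u v)
∑∑-symmetric {n} p g g-sym split = begin
  ∑ (λ u → ∑ (g u))
    ≡⟨ sum-cong-≗ (λ u → trans (sum-cong-≗ (split u)) (∑-distrib-+ (λ v → p u v * g u v) _)) ⟩
  ∑ (λ u → ∑ (λ v → p u v * g u v) + ∑ (λ v → p v u * g u v))
    ≡⟨ ∑-distrib-+ (λ u → ∑ λ v → p u v * g u v) _ ⟩
  S + ∑ (λ u → ∑ (λ v → p v u * g u v))
    ≡⟨ cong (S +_) (∑-comm λ u v → p v u * g u v) ⟩
  S + ∑ (λ v → ∑ (λ u → p v u * g u v))
    ≡⟨ cong (S +_) (sum-cong-≗ λ v → sum-cong-≗ λ u → cong (p v u *_) (g-sym u v)) ⟩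
  S + S
    ≡⟨ cong (S +_) (+-identityʳ S) ⟨
  2 * S ∎
  where
  open ≡-Reasoning
  S = ∑ (λ u → ∑ λ v → p u v * g u v)

-- Double counting over the edges of a graph

module Counting {n : ℕ} (G : Graph n) where
  open Graph G

  adj : Fin n → Fin n → ℕ
  adj u v = 𝟙 (u ~? v)

  adj-sym : ∀ u v → adj u v ≡ adj v u
  adj-sym u v = 𝟙-cong (u ~? v) (v ~? u) ~-sym ~-sym

  degree-∑ : ∀ u → degree u ≡ ∑ (adj u)
  degree-∑ u = trans (length-filter (u ~?_) (allFin n)) (sum-map-tabulate (adj u) id)

  ∑edges : (Fin n → Fin n → ℕ) → ℕ
  ∑edges f = sum (map (uncurry f) edges)

  ∑edges-∑∑ : ∀ f → ∑edges f ≡ ∑ λ u → ∑ λ v → 𝟙 (u Fin.<? v) * (adj u v * f u v)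
  ∑edges-∑∑ f = begin
    sum (map (uncurry f) edges)
      ≡⟨ sum-map-filter (λ (u , v) → (u Fin.<? v) ×-dec (u ~? v)) (uncurry f)
           (cartesianProduct (allFin n) (allFin n)) ⟩
    sum (map (λ (u , v) → w u v) (cartesianProduct (allFin n) (allFin n)))
      ≡⟨ sum-map-cartesianProduct (λ (u , v) → w u v) (allFin n) (allFin n) ⟩
    sum (map (λ u → sum (map (w u) (allFin n))) (allFin n))
      ≡⟨ sum-map-tabulate (λ u → sum (map (w u) (allFin n))) id ⟩
    ∑ (λ u → sum (map (w u) (allFin n)))
      ≡⟨ sum-cong-≗ (λ u → sum-map-tabulate (w u) id) ⟩
    ∑ (λ u → ∑ (w u))
      ≡⟨ sum-cong-≗ (λ u → sum-cong-≗ λ v → 𝟙-×-* (u Fin.<? v) (u ~? v) (f u v)) ⟩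
    _ ∎
    where
    open ≡-Reasoning
    w : Fin n → Fin n → ℕ
    w u v = 𝟙 ((u Fin.<? v) ×-dec (u ~? v)) * f u v

  -- Adjacent vertices are distinct, so exactly one of the orders `u < v` and `v < u` holds, and the
  -- list `edges` contains that one.
  ∑∑-adj : ∀ f → (∀ u v → f u v ≡ f v u) → ∑ (λ u → ∑ λ v → adj u v * f u v) ≡ 2 * ∑edges f
  ∑∑-adj f f-sym = trans
    (∑∑-symmetric (λ u v → 𝟙 (u Fin.<? v)) (λ u v → adj u v * f u v)
      (λ u v → cong₂ _*_ (adj-sym u v) (f-sym u v)) split)
    (cong (2 *_) (sym (∑edges-∑∑ f)))
    where
    rewrite-𝟙 : ∀ {a b a′ b′} k → a ≡ a′ → b ≡ b′ → k ≡ a′ * k + b′ * k → k ≡ a * k + b * k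
    rewrite-𝟙 k refl refl eq = eq
    one-order : ∀ u v → u ~ v → f u v ≡ 𝟙 (u Fin.<? v) * f u v + 𝟙 (v Fin.<? u) * f u v
    one-order u v u~v with Fin.<-cmp u v
    ... | tri< u<v _ v≮u = rewrite-𝟙 (f u v) (𝟙-yes (u Fin.<? v) u<v) (𝟙-no (v Fin.<? u) v≮u)
      (sym (trans (+-identityʳ _) (*-identityˡ (f u v))))
    ... | tri≈ _ u≡v _   = contradiction u~v (~-irrefl u≡v)
    ... | tri> u≮v _ v<u = rewrite-𝟙 (f u v) (𝟙-no (u Fin.<? v) u≮v) (𝟙-yes (v Fin.<? u) v<u)
      (sym (*-identityˡ (f u v)))
    split : ∀ u v → adj u v * f u v ≡ 𝟙 (u Fin.<? v) * (adj u v * f u v) + 𝟙 (v Fin.<? u) * (adj u v * f u v)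
    split u v = trans (𝟙-*-cong (u ~? v) (one-order u v))
      (solve 4 (λ a p q x → a :* (p :* x :+ q :* x) := p :* (a :* x) :+ q :* (a :* x)) refl
        (adj u v) (𝟙 (u Fin.<? v)) (𝟙 (v Fin.<? u)) (f u v))

  -- If the weight of an edge is the sum of the shares of its ends, each vertex pays its share once
  -- per incident edge. The proof doubles both sides to pass to ordered pairs. The formulas for `σ`,
  -- `m Δ Δ` and `m 2 2` are all instances.
  ∑edges-endpoints : ∀ f (a : Fin n → ℕ) →
    (∀ u v → f u v ≡ f v u) → (∀ {u v} → u ~ v → f u v ≡ a u + a v) →
    ∑edges f ≡ ∑ λ u → degree u * a u
  ∑edges-endpoints f a f-sym f≡a+a = *-cancelˡ-≡ _ _ 2 (begin
    2 * ∑edges f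
      ≡⟨ ∑∑-adj f f-sym ⟨
    ∑ (λ u → ∑ λ v → adj u v * f u v)
      ≡⟨ sum-cong-≗ (λ u → sum-cong-≗ λ v →
           trans (𝟙-*-cong (u ~? v) f≡a+a) (*-distribˡ-+ (adj u v) (a u) (a v))) ⟩
    ∑ (λ u → ∑ λ v → adj u v * a u + adj u v * a v)
      ≡⟨ trans (sum-cong-≗ λ u → ∑-distrib-+ (λ v → adj u v * a u) _)
               (∑-distrib-+ (λ u → ∑ λ v → adj u v * a u) _) ⟩
    ∑ (λ u → ∑ λ v → adj u v * a u) + ∑ (λ u → ∑ λ v → adj u v * a v)
      ≡⟨ cong (∑ (λ u → ∑ λ v → adj u v * a u) +_) (trans (∑-comm λ u v → adj u v * a v)
           (sum-cong-≗ λ v → sum-cong-≗ λ u → cong (_* a v) (adj-sym u v))) ⟩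
    ∑ (λ u → ∑ λ v → adj u v * a u) + ∑ (λ u → ∑ λ v → adj u v * a u)
      ≡⟨ cong (∑ (λ u → ∑ λ v → adj u v * a u) +_) (+-identityʳ _) ⟨
    2 * ∑ (λ u → ∑ λ v → adj u v * a u)
      ≡⟨ cong (2 *_) (sum-cong-≗ pull) ⟩
    2 * ∑ (λ u → degree u * a u) ∎)
    where
    open ≡-Reasoning
    pull : ∀ u → ∑ (λ v → adj u v * a u) ≡ degree u * a u
    pull u = begin
      ∑ (λ v → adj u v * a u) ≡⟨ sum-cong-≗ (λ v → *-comm (adj u v) (a u)) ⟩
      ∑ (λ v → a u * adj u v) ≡⟨ *-distribˡ-sum (a u) (adj u) ⟨
      a u * ∑ (adj u)         ≡⟨ *-comm (a u) _ ⟩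
      ∑ (adj u) * a u         ≡⟨ cong (_* a u) (degree-∑ u) ⟨
      degree u * a u          ∎

  length-edges : length edges ≡ ∑edges (λ _ _ → 1)
  length-edges = length≡sum edges
    where
    length≡sum : ∀ {A : Set} (xs : List A) → length xs ≡ sum (map (λ _ → 1) xs)
    length≡sum []       = refl
    length≡sum (_ ∷ xs) = cong suc (length≡sum xs)

  ∑-degree : ∑ degree ≡ 2 * length edges
  ∑-degree = begin
    ∑ degree                            ≡⟨ sum-cong-≗ degree-∑ ⟩
    ∑ (λ u → ∑ (adj u))                 ≡⟨ sum-cong-≗ (λ u → sum-cong-≗ λ v → *-identityʳ (adj u v)) ⟨
    ∑ (λ u → ∑ λ v → adj u v * 1)       ≡⟨ ∑∑-adj (λ _ _ → 1) (λ _ _ → refl) ⟩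
    2 * ∑edges (λ _ _ → 1)              ≡⟨ cong (2 *_) length-edges ⟨
    2 * length edges                    ∎
    where open ≡-Reasoning

  -- Definitionally the predicate by which `m i j` filters the edges.
  bothDegrees? : ∀ i j (e : Fin n × Fin n) → Dec
    ((degree (proj₁ e) ≡ i × degree (proj₂ e) ≡ j) ⊎ (degree (proj₁ e) ≡ j × degree (proj₂ e) ≡ i))
  bothDegrees? i j (u , v) = ((degree u ≟ i) ×-dec (degree v ≟ j)) ⊎-dec
                             ((degree u ≟ j) ×-dec (degree v ≟ i))

  m-∑edges : ∀ i j → m i j ≡ ∑edges (λ u v → 𝟙 (bothDegrees? i j (u , v)))
  m-∑edges i j = length-filter (bothDegrees? i j) edges

  ∑-𝟙-degree : ∀ u {P : Fin n → Set} (P? : ∀ v → Dec (P v)) → (∀ {v} → P v → u ~ v) → ∑ (𝟙 ∘ P?) ≤ degree u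
  ∑-𝟙-degree u P? P⊆ = subst (∑ (𝟙 ∘ P?) ≤_) (sym (degree-∑ u)) (∑-mono 𝟙≤)
    where
    𝟙≤ : ∀ v → 𝟙 (P? v) ≤ adj u v
    𝟙≤ v with P? v
    ... | yes p = ≤-reflexive (sym (𝟙-yes (u ~? v) (P⊆ p)))
    ... | no _  = z≤n

  -- For distinct entries the length is the sum of the membership indicators, each of which is
  -- bounded by adjacency to `u`. Exhibiting distinct neighbours thus bounds a degree from below.
  Unique⇒length≤degree : ∀ {u vs} → Unique vs → All (u ~_) vs → length vs ≤ degree u
  Unique⇒length≤degree {u} {vs} unique adjacent =
    ≤-trans (≤-reflexive (sym (∑-∈ unique))) (∑-𝟙-degree u (_∈? vs) (All.lookup adjacent))
    where
    ∑-∈ : ∀ {vs} → Unique vs → ∑ (λ x → 𝟙 (x ∈? vs)) ≡ length vs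
    ∑-∈ []            = ∑-zero {n}
    ∑-∈ {v ∷ vs} (v∉vs ∷ uvs) = begin
      ∑ (λ x → 𝟙 (x ∈? (v ∷ vs)))                       ≡⟨ sum-cong-≗ split ⟩
      ∑ (λ x → 𝟙 (x Fin.≟ v) + 𝟙 (x ∈? vs))             ≡⟨ ∑-distrib-+ (λ x → 𝟙 (x Fin.≟ v)) _ ⟩
      ∑ (λ x → 𝟙 (x Fin.≟ v)) + ∑ (λ x → 𝟙 (x ∈? vs))   ≡⟨ cong₂ _+_ (∑-𝟙≟ v) (∑-∈ uvs) ⟩
      suc (length vs)                                     ∎
      where
      open ≡-Reasoning
      split : ∀ x → 𝟙 (x ∈? (v ∷ vs)) ≡ 𝟙 (x Fin.≟ v) + 𝟙 (x ∈? vs)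
      split x with x Fin.≟ v
      ... | yes refl = cong suc (sym (𝟙-no (v ∈? vs) λ v∈vs → All.lookup v∉vs v∈vs refl))
      ... | no _     = refl

  ∑edges-+ : ∀ f g → ∑edges (λ u v → f u v + g u v) ≡ ∑edges f + ∑edges g
  ∑edges-+ f g = sum-map-+ edges
    where
    sum-map-+ : ∀ es → sum (map (uncurry λ u v → f u v + g u v) es) ≡
                       sum (map (uncurry f) es) + sum (map (uncurry g) es)
    sum-map-+ []             = refl
    sum-map-+ ((u , v) ∷ es) = trans (cong (f u v + g u v +_) (sum-map-+ es))
      (solve 4 (λ a b c d → (a :+ b) :+ (c :+ d) := (a :+ c) :+ (b :+ d)) refl
        (f u v) (g u v) (sum (map (uncurry f) es)) _)

  bothDegrees-sym : ∀ i j u v → 𝟙 (bothDegrees? i j (u , v)) ≡ 𝟙 (bothDegrees? i j (v , u))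
  bothDegrees-sym i j u v = 𝟙-cong (bothDegrees? i j (u , v)) (bothDegrees? i j (v , u)) reorder reorder
    where
    reorder : ∀ {A B C D : Set} → (A × B) ⊎ (C × D) → (D × C) ⊎ (B × A)
    reorder = Sum.swap ∘ Sum.map swap swap

  ∈-edges : ∀ {u v} → u Fin.< v → u ~ v → Any.Any ((u , v) ≡_) edges
  ∈-edges {u} {v} u<v u~v = ∈-filter⁺ (λ (u , v) → (u Fin.<? v) ×-dec (u ~? v))
    (∈-cartesianProduct⁺ (∈-allFin u) (∈-allFin v)) (u<v , u~v)

  -- The edge is listed in one of its two orders, and the two disjuncts in `m` accept either. This
  -- is what lets `m 2 2 ≡ 0` exclude an edge.
  m>0 : ∀ {u v} → u ~ v → 0 < m (degree u) (degree v)
  m>0 {u} {v} u~v with Fin.<-cmp u v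
  ... | tri< u<v _ _ = ∈-length (∈-filter⁺ (bothDegrees? _ _) (∈-edges u<v u~v) (inj₁ (refl , refl)))
  ... | tri≈ _ u≡v _ = contradiction u~v (~-irrefl u≡v)
  ... | tri> _ _ v<u = ∈-length (∈-filter⁺ (bothDegrees? _ _) (∈-edges v<u (~-sym u~v)) (inj₂ (refl , refl)))

  numberOfDegree : ℕ → ℕ
  numberOfDegree i = ∑ λ u → 𝟙 (degree u ≟ i)

  ∑-degree*𝟙 : ∀ i → ∑ (λ u → degree u * 𝟙 (degree u ≟ i)) ≡ i * numberOfDegree i
  ∑-degree*𝟙 i = trans (sum-cong-≗ pointwise) (sym (*-distribˡ-sum i λ u → 𝟙 (degree u ≟ i)))
    where
    pointwise : ∀ u → degree u * 𝟙 (degree u ≟ i) ≡ i * 𝟙 (degree u ≟ i)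
    pointwise u = trans (*-comm (degree u) _) (trans (𝟙-*-cong (degree u ≟ i) id) (*-comm _ i))

-- Least witnesses, loop erasure and cycles

least : {P : ℕ → Set} → Decidable P → ∀ k → P k → ∃ λ i → P i × (∀ {j} → P j → i ≤ j)
least P? zero    p = 0 , p , λ _ → z≤n
least P? (suc k) p with P? 0
... | yes p₀ = 0 , p₀ , λ _ → z≤n
... | no ¬p₀ with least (P? ∘ suc) k p
...   | i , pᵢ , minimal =
  suc i , pᵢ , λ { {zero} p₀ → contradiction p₀ ¬p₀ ; {suc _} pⱼ → s≤s (minimal pⱼ) }

module Paths {n : ℕ} (G : Graph n) where
  open Graph G

  -- The list contains both ends. The final vertex is a parameter because passing to a suffix keeps
  -- it.
  data SimplePath (z : Fin n) : Fin n → List (Fin n) → Set where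
    stop : SimplePath z z [ z ]
    step : ∀ {x y vs} → x ~ y → All (x ≢_) vs → SimplePath z y vs → SimplePath z x (x ∷ vs)

  private variable
    c x y z : Fin n
    vs : List (Fin n)

  SimplePath-unique : SimplePath z x vs → Unique vs
  SimplePath-unique stop            = [] ∷ []
  SimplePath-unique (step _ x∉vs p) = x∉vs ∷ SimplePath-unique p

  SimplePath-linked : SimplePath z y vs → x ~ y → z ~ c → Linked _~_ (x ∷ vs ++ [ c ])
  SimplePath-linked stop             x~z z~c = x~z ∷ (z~c ∷ [-])
  SimplePath-linked (step y~y′ _ p) x~y z~c = x~y ∷ SimplePath-linked p y~y′ z~c

  SimplePath-length : x ≢ z → SimplePath z x vs → 2 ≤ length vs
  SimplePath-length x≢z stop                      = contradiction refl x≢z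
  SimplePath-length x≢z (step _ _ stop)           = s≤s (s≤s z≤n)
  SimplePath-length x≢z (step _ _ (step _ _ p))   = s≤s (s≤s z≤n)

  SimplePath-suffix : {P : Fin n → Set} → SimplePath z y vs → x ∈ vs → All P vs →
                      ∃ λ ws → SimplePath z x ws × All P ws
  SimplePath-suffix stop                 (here refl)  pvs       = _ , stop , pvs
  SimplePath-suffix p@(step _ _ _)       (here refl)  pvs       = _ , p , pvs
  SimplePath-suffix (step _ _ p)         (there x∈vs) (_ ∷ pvs) = SimplePath-suffix p x∈vs pvs

  -- Both ends are required to differ from `c`, which makes the relation symmetric, so that walks
  -- can be reversed.
  Avoiding : Fin n → Fin n → Fin n → Set
  Avoiding c x y = x ~ y × c ≢ x × c ≢ y

  -- The tail of the walk is made simple first. If its path already visits `x`, the suffix from that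
  -- visit replaces everything before it.
  eraseLoops : c ≢ x → Star (Avoiding c) x z → ∃ λ vs → SimplePath z x vs × All (c ≢_) vs
  eraseLoops c≢x ε = _ , stop , c≢x ∷ []
  eraseLoops {x = x} c≢x ((x~y , _ , c≢y) ◅ walk) with eraseLoops c≢y walk
  ... | vs , p , c∉vs with x ∈? vs
  ...   | yes x∈vs = SimplePath-suffix p x∈vs c∉vs
  ...   | no x∉vs  = x ∷ vs , step x~y (All.¬Any⇒All¬ vs x∉vs) p , c≢x ∷ c∉vs

  -- A simple path from `x` to `z` that misses `c` closes up through `c`; as `x` and `z` differ, it
  -- has at least two vertices.
  detour-cycle : c ~ x → c ~ z → x ≢ z → Star (Avoiding c) x z → ∃ λ vs → IsCycle c vs
  detour-cycle c~x c~z x≢z walk with eraseLoops (λ c≡x → ~-irrefl c≡x c~x) walk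
  ... | vs , p , c∉vs =
    vs , SimplePath-length x≢z p , c∉vs ∷ SimplePath-unique p , SimplePath-linked p c~x (~-sym c~z)

-- Distance to a root

module Height {n : ℕ} (G : Graph n) (connected : Graph.Connected G) (r : Fin n) where
  open Graph G

  private variable
    u v : Fin n

  -- Walks to the root of an exact length. Unlike `Star`, this is decidable by searching through the
  -- vertices, so a least length can be found.
  Walk : ℕ → Fin n → Set
  Walk zero    v = v ≡ r
  Walk (suc ℓ) v = ∃ λ u → v ~ u × Walk ℓ u

  walk? : ∀ ℓ → Decidable (Walk ℓ)
  walk? zero    v = v Fin.≟ r
  walk? (suc ℓ) v = Fin.any? λ u → (v ~? u) ×-dec walk? ℓ u

  Star⇒Walk : Star _~_ v r → ∃ λ ℓ → Walk ℓ v
  Star⇒Walk ε = 0 , refl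
  Star⇒Walk (v~u ◅ walk) with Star⇒Walk walk
  ... | ℓ , w = suc ℓ , _ , v~u , w

  shortest : ∀ v → ∃ λ ℓ → Walk ℓ v × (∀ {ℓ′} → Walk ℓ′ v → ℓ ≤ ℓ′)
  shortest v with Star⇒Walk (connected v r)
  ... | ℓ , w = least (λ ℓ → walk? ℓ v) ℓ w

  height : Fin n → ℕ
  height = proj₁ ∘ shortest

  root-lowest : ∀ u → ¬ height u < height r
  root-lowest u hu<hr = n≮0 (<-≤-trans hu<hr (proj₂ (proj₂ (shortest r)) refl))

  -- The first step of a shortest walk to the root: what remains of the walk bounds the height of
  -- its end.
  lowerNeighbour : v ≢ r → ∃ λ u → v ~ u × height u < height v
  lowerNeighbour {v} v≢r with shortest v
  ... | zero  , v≡r           , _ = contradiction v≡r v≢r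
  ... | suc ℓ , (u , v~u , w) , _ = u , v~u , s≤s (proj₂ (proj₂ (shortest u)) w)

  open Paths G

  -- Stepping from lower neighbour to lower neighbour leads to the root. Every vertex after `x` is
  -- strictly below `c` and hence differs from it.
  descend : ∀ c x → c ≢ x → height x ≤ height c → Star (Avoiding c) x r
  descend c x = go (height x) x refl
    where
    go : ∀ h x → height x ≡ h → c ≢ x → height x ≤ height c → Star (Avoiding c) x r
    go = <-rec _ λ { h rec x refl c≢x hx≤hc → case x Fin.≟ r of λ
      { (yes refl) → ε
      ; (no x≢r) →
          let y , x~y , hy<hx = lowerNeighbour x≢r
              hy<hc = <-≤-trans hy<hx hx≤hc
              c≢y = λ { refl → <-irrefl refl hy<hc }
          in (x~y , c≢x , c≢y) ◅ rec hy<hx y refl c≢y (<⇒≤ hy<hc) } }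

  -- Two such neighbours are joined by descending walks through the root, which avoid v.
  lowNeighbour-unique : Acyclic → ∀ {v a b} → v ~ a → v ~ b →
                        height a ≤ height v → height b ≤ height v → a ≡ b
  lowNeighbour-unique acyclic {v} {a} {b} v~a v~b ha≤hv hb≤hv with a Fin.≟ b
  ... | yes a≡b = a≡b
  ... | no a≢b  = contradiction (proj₂ cycle) (acyclic _ _)
    where
    ≢nbr : v ~ u → v ≢ u
    ≢nbr v~u v≡u = ~-irrefl v≡u v~u
    cycle : ∃ λ vs → IsCycle v vs
    cycle = detour-cycle v~a v~b a≢b
      (descend v a (≢nbr v~a) ha≤hv ◅◅
       reverse (λ (x~y , v≢x , v≢y) → ~-sym x~y , v≢y , v≢x) (descend v b (≢nbr v~b) hb≤hv))

-- The number of edges of a tree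

module TreeEdges {n : ℕ} (G : Graph n) (isTree : Graph.IsTree G) where
  open Graph G
  open IsTree isTree
  open Counting G

  root : Fin n
  root = Fin.fromℕ< (>-nonZero⁻¹ n {{nonEmpty}})

  open Height G connected root

  -- Suppose the ends have equal heights. If `u` is the root, then `v` has a neighbour below the
  -- root. Otherwise `u` has a strictly lower neighbour, which by uniqueness of low neighbours must
  -- be `v`. Both are absurd.
  edge-height : ∀ u v → u ~ v → height u < height v ⊎ height v < height u
  edge-height u v u~v with <-cmp (height u) (height v)
  ... | tri< hu<hv _ _ = inj₁ hu<hv
  ... | tri> _ _ hv<hu = inj₂ hv<hu
  ... | tri≈ _ hu≡hv _ with u Fin.≟ root
  ...   | yes refl = let w , _ , hw<hv = lowerNeighbour v≢root
                     in contradiction (subst (height w <_) (sym hu≡hv) hw<hv) (root-lowest w)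
    where
    v≢root : v ≢ root
    v≢root v≡root = ~-irrefl (sym v≡root) u~v
  ...   | no u≢root with lowerNeighbour u≢root
  ...     | w , u~w , hw<hu with lowNeighbour-unique acyclic u~w u~v (<⇒≤ hw<hu) (≤-reflexive (sym hu≡hv))
  ...       | refl = contradiction (sym hu≡hv) (<⇒≢ hw<hu)

  lower? : ∀ u v → Dec (u ~ v × height v < height u)
  lower? u v = (u ~? v) ×-dec (height v <? height u)

  -- Every vertex has exactly one parent, except the root, which has none and is made up for by the
  -- second indicator.
  lower+root : ∀ u → ∑ (𝟙 ∘ lower? u) + 𝟙 (u Fin.≟ root) ≡ 1
  lower+root u with u Fin.≟ root
  ... | yes refl = cong (_+ 1) (trans
    (sum-cong-≗ λ v → 𝟙-no (lower? root v) λ (_ , hv<hr) → root-lowest v hv<hr) (∑-zero {n}))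
  ... | no u≢root with lowerNeighbour u≢root
  ...   | w , u~w , hw<hu = trans (+-identityʳ _) (∑-𝟙-unique (lower? u) w (u~w , hw<hu)
          λ v (u~v , hv<hu) → lowNeighbour-unique acyclic u~v u~w (<⇒≤ hv<hu) (<⇒≤ hw<hu))

  1+∣edges∣≡n : length edges + 1 ≡ n
  1+∣edges∣≡n = begin
    length edges + 1
      -- The degree sum is twice the number of edges and also twice the number of pairs of a vertex
      -- and a lower neighbour. The summand `1` is spread over the vertices as the indicator of the
      -- root.
      ≡⟨ cong₂ _+_ (*-cancelˡ-≡ _ _ 2 (trans (sym ∑-degree) (trans (sum-cong-≗ degree-∑) ∑∑-adj-lower)))
                   (sym (∑-𝟙≟ root)) ⟩
    ∑ (λ u → ∑ (𝟙 ∘ lower? u)) + ∑ (λ u → 𝟙 (u Fin.≟ root))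
      ≡⟨ ∑-distrib-+ (λ u → ∑ (𝟙 ∘ lower? u)) _ ⟨
    ∑ (λ u → ∑ (𝟙 ∘ lower? u) + 𝟙 (u Fin.≟ root))
      ≡⟨ trans (sum-cong-≗ lower+root) (∑-one {n}) ⟩
    n ∎
    where
    open ≡-Reasoning
    p : Fin n → Fin n → ℕ
    p u v = 𝟙 (height v <? height u)
    split : ∀ u v → adj u v ≡ p u v * adj u v + p v u * adj u v
    split u v with u ~? v
    ... | no _ = sym (cong₂ _+_ (*-zeroʳ (p u v)) (*-zeroʳ (p v u)))
    ... | yes u~v with edge-height u v u~v
    ...   | inj₁ hu<hv = sym (cong₂ (λ a b → a * 1 + b * 1)
      (𝟙-no (height v <? height u) (<-asym hu<hv)) (𝟙-yes (height u <? height v) hu<hv))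
    ...   | inj₂ hv<hu = sym (cong₂ (λ a b → a * 1 + b * 1)
      (𝟙-yes (height v <? height u) hv<hu) (𝟙-no (height u <? height v) (<-asym hv<hu)))
    lower-* : ∀ u v → p u v * adj u v ≡ 𝟙 (lower? u v)
    lower-* u v = begin
      p u v * adj u v ≡⟨ *-comm (p u v) _ ⟩
      adj u v * p u v ≡⟨ cong (adj u v *_) (*-identityʳ (p u v)) ⟨
      adj u v * (p u v * 1) ≡⟨ 𝟙-×-* (u ~? v) (height v <? height u) 1 ⟨
      𝟙 (lower? u v) * 1 ≡⟨ *-identityʳ _ ⟩
      𝟙 (lower? u v) ∎
    ∑∑-adj-lower : ∑ (λ u → ∑ (adj u)) ≡ 2 * ∑ (λ u → ∑ (𝟙 ∘ lower? u))
    ∑∑-adj-lower = trans (∑∑-symmetric p adj adj-sym split)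
      (cong (2 *_) (sum-cong-≗ λ u → sum-cong-≗ (lower-* u)))

-- Trees whose vertices of degree Δ cover all edges

module ΔCover (δ : ℕ) where

  Δ = 3 + δ

  Deg∈ : ℕ → Set
  Deg∈ d = d ≡ 1 ⊎ d ≡ 2 ⊎ d ≡ Δ

  -- The vertices of degree `Δ` form a vertex cover. Trees of the family and the constructed trees
  -- are both compared with this notion, on which all the counting rests.
  record IsΔCovered {n : ℕ} (G : Graph n) : Set where
    open Graph G
    field
      degree∈ : ∀ v → Deg∈ (degree v)
      covered : ∀ {u v} → u ~ v → degree u ≡ Δ ⊎ degree v ≡ Δ

  -- The contribution to σ of an edge, charged to its end that is not of degree Δ.
  charge : ℕ → ℕ
  charge d = (2 + δ) ^ 2 * 𝟙 (d ≟ 1) + (1 + δ) ^ 2 * 𝟙 (d ≟ 2)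

  charge-Δ : charge Δ ≡ 0
  charge-Δ = cong₂ _+_ (*-zeroʳ ((2 + δ) ^ 2)) (*-zeroʳ ((1 + δ) ^ 2))

  ∣Δ-d∣²≡charge : ∀ {d} → Deg∈ d → ∣ Δ - d ∣ ^ 2 ≡ charge d
  ∣Δ-d∣²≡charge (inj₁ refl) = sym (trans
    (cong₂ _+_ (*-identityʳ ((2 + δ) ^ 2)) (*-zeroʳ ((1 + δ) ^ 2))) (+-identityʳ _))
  ∣Δ-d∣²≡charge (inj₂ (inj₁ refl)) = sym (cong₂ _+_ (*-zeroʳ ((2 + δ) ^ 2)) (*-identityʳ ((1 + δ) ^ 2)))
  ∣Δ-d∣²≡charge (inj₂ (inj₂ refl)) = trans (cong (_^ 2) (∣n-n∣≡0 Δ)) (sym charge-Δ)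

  𝟙-Deg∈ : ∀ {d} → Deg∈ d → 𝟙 (d ≟ 1) + 𝟙 (d ≟ 2) + 𝟙 (d ≟ Δ) ≡ 1
  𝟙-Deg∈ (inj₁ refl)        = refl
  𝟙-Deg∈ (inj₂ (inj₁ refl)) = refl
  𝟙-Deg∈ (inj₂ (inj₂ refl)) = 𝟙-yes (Δ ≟ Δ) refl

  module Counts {n : ℕ} (G : Graph n) (isTree : Graph.IsTree G) (isΔCovered : IsΔCovered G) where
    open Graph G
    open IsΔCovered isΔCovered
    open Counting G
    open TreeEdges G isTree public using (1+∣edges∣≡n)

    N₁ = numberOfDegree 1
    N₂ = numberOfDegree 2
    NΔ = numberOfDegree Δ

    private
      t : ℕ → Fin n → ℕ
      t i u = degree u * 𝟙 (degree u ≟ i)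

    numberOfVertices : N₁ + N₂ + NΔ ≡ n
    numberOfVertices = begin
      N₁ + N₂ + NΔ
        ≡⟨ cong (_+ NΔ) (∑-distrib-+ (λ u → 𝟙 (degree u ≟ 1)) _) ⟨
      ∑ (λ u → 𝟙 (degree u ≟ 1) + 𝟙 (degree u ≟ 2)) + NΔ
        ≡⟨ ∑-distrib-+ (λ u → 𝟙 (degree u ≟ 1) + 𝟙 (degree u ≟ 2)) _ ⟨
      ∑ (λ u → 𝟙 (degree u ≟ 1) + 𝟙 (degree u ≟ 2) + 𝟙 (degree u ≟ Δ))
        ≡⟨ sum-cong-≗ (𝟙-Deg∈ ∘ degree∈) ⟩
      ∑ {n} (λ _ → 1)
        ≡⟨ ∑-one ⟩
      n ∎
      where open ≡-Reasoning

    degreeSum : 1 * N₁ + 2 * N₂ + Δ * NΔ ≡ 2 * length edges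
    degreeSum = begin
      1 * N₁ + 2 * N₂ + Δ * NΔ
        ≡⟨ cong₂ _+_ (cong₂ _+_ (∑-degree*𝟙 1) (∑-degree*𝟙 2)) (∑-degree*𝟙 Δ) ⟨
      ∑ (t 1) + ∑ (t 2) + ∑ (t Δ)
        ≡⟨ cong (_+ ∑ (t Δ)) (∑-distrib-+ (t 1) (t 2)) ⟨
      ∑ (λ u → t 1 u + t 2 u) + ∑ (t Δ)
        ≡⟨ ∑-distrib-+ (λ u → t 1 u + t 2 u) (t Δ) ⟨
      ∑ (λ u → t 1 u + t 2 u + t Δ u)
        ≡⟨ sum-cong-≗ (λ u → solve 4 (λ d x y z → d :* x :+ d :* y :+ d :* z := d :* (x :+ y :+ z)) refl
             (degree u) (𝟙 (degree u ≟ 1)) (𝟙 (degree u ≟ 2)) (𝟙 (degree u ≟ Δ))) ⟩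
      ∑ (λ u → degree u * (𝟙 (degree u ≟ 1) + 𝟙 (degree u ≟ 2) + 𝟙 (degree u ≟ Δ)))
        ≡⟨ sum-cong-≗ (λ u → trans (cong (degree u *_) (𝟙-Deg∈ (degree∈ u))) (*-identityʳ (degree u))) ⟩
      ∑ degree
        ≡⟨ ∑-degree ⟩
      2 * length edges ∎
      where
      open ≡-Reasoning

    -- One end of each edge has degree `Δ` and charge zero, so the squared difference is the charge
    -- of the other end. A leaf pays its charge once and a vertex of degree 2 pays twice, whence the
    -- factors `1` and `2`.
    σ-formula : σ ≡ (2 + δ) ^ 2 * (1 * N₁) + (1 + δ) ^ 2 * (2 * N₂)
    σ-formula = begin
      σ
        ≡⟨ ∑edges-endpoints (λ u v → ∣ degree u - degree v ∣ ^ 2) (charge ∘ degree)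
             (λ u v → cong (_^ 2) (∣-∣-comm (degree u) (degree v))) edge ⟩
      ∑ (λ u → degree u * charge (degree u))
        ≡⟨ sum-cong-≗ (λ u → solve 5 (λ d a b x y → d :* (a :* x :+ b :* y) := a :* (d :* x) :+ b :* (d :* y)) refl
             (degree u) ((2 + δ) ^ 2) ((1 + δ) ^ 2) (𝟙 (degree u ≟ 1)) (𝟙 (degree u ≟ 2))) ⟩
      ∑ (λ u → (2 + δ) ^ 2 * t 1 u + (1 + δ) ^ 2 * t 2 u)
        ≡⟨ ∑-distrib-+ (λ u → (2 + δ) ^ 2 * t 1 u) _ ⟩
      ∑ (λ u → (2 + δ) ^ 2 * t 1 u) + ∑ (λ u → (1 + δ) ^ 2 * t 2 u)
        ≡⟨ cong₂ _+_ (*-distribˡ-sum ((2 + δ) ^ 2) (t 1)) (*-distribˡ-sum ((1 + δ) ^ 2) (t 2)) ⟨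
      (2 + δ) ^ 2 * ∑ (t 1) + (1 + δ) ^ 2 * ∑ (t 2)
        ≡⟨ cong₂ (λ x y → (2 + δ) ^ 2 * x + (1 + δ) ^ 2 * y) (∑-degree*𝟙 1) (∑-degree*𝟙 2) ⟩
      (2 + δ) ^ 2 * (1 * N₁) + (1 + δ) ^ 2 * (2 * N₂) ∎
      where
      open ≡-Reasoning
      edge : ∀ {u v} → u ~ v → ∣ degree u - degree v ∣ ^ 2 ≡ charge (degree u) + charge (degree v)
      edge {u} {v} u~v with covered u~v
      ... | inj₁ du≡Δ = trans (cong (λ d → ∣ d - degree v ∣ ^ 2) du≡Δ) (trans (∣Δ-d∣²≡charge (degree∈ v))
                          (cong (_+ charge (degree v)) (sym (trans (cong charge du≡Δ) charge-Δ))))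
      ... | inj₂ dv≡Δ = trans (cong (λ d → ∣ degree u - d ∣ ^ 2) dv≡Δ) (trans (cong (_^ 2) (∣-∣-comm (degree u) Δ))
                          (trans (∣Δ-d∣²≡charge (degree∈ u)) (sym (trans
                            (cong (charge (degree u) +_) (trans (cong charge dv≡Δ) charge-Δ)) (+-identityʳ _)))))

    -- Both sides count pairs of an edge and an end of it of degree `Δ`: each edge has one such end,
    -- and the edges counted by `m Δ Δ` have a second.
    mΔΔ+∣edges∣ : m Δ Δ + length edges ≡ Δ * NΔ
    mΔΔ+∣edges∣ = begin
      m Δ Δ + length edges
        ≡⟨ cong₂ _+_ (m-∑edges Δ Δ) length-edges ⟩
      ∑edges both + ∑edges (λ _ _ → 1)
        ≡⟨ ∑edges-+ both (λ _ _ → 1) ⟨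
      ∑edges (λ u v → both u v + 1)
        ≡⟨ ∑edges-endpoints (λ u v → both u v + 1) (λ u → 𝟙 (degree u ≟ Δ))
             (λ u v → cong (_+ 1) (bothDegrees-sym Δ Δ u v)) edge ⟩
      ∑ (λ u → degree u * 𝟙 (degree u ≟ Δ))
        ≡⟨ ∑-degree*𝟙 Δ ⟩
      Δ * NΔ ∎
      where
      open ≡-Reasoning
      both : Fin n → Fin n → ℕ
      both u v = 𝟙 (bothDegrees? Δ Δ (u , v))
      edge : ∀ {u v} → u ~ v → both u v + 1 ≡ 𝟙 (degree u ≟ Δ) + 𝟙 (degree v ≟ Δ)
      edge {u} {v} u~v = 𝟙-both (degree u ≟ Δ) (degree v ≟ Δ) (covered u~v)

    m₂₂≡0 : m 2 2 ≡ 0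
    m₂₂≡0 = begin
      m 2 2
        ≡⟨ m-∑edges 2 2 ⟩
      ∑edges (λ u v → 𝟙 (bothDegrees? 2 2 (u , v)))
        ≡⟨ ∑edges-endpoints _ (λ _ → 0) (bothDegrees-sym 2 2)
             (λ {u} {v} u~v → 𝟙-no (bothDegrees? 2 2 (u , v)) ([ notBoth u~v , notBoth u~v ]′)) ⟩
      ∑ (λ u → degree u * 0)
        ≡⟨ trans (sum-cong-≗ (*-zeroʳ ∘ degree)) (∑-zero {n}) ⟩
      0 ∎
      where
      open ≡-Reasoning
      notBoth : ∀ {u v} → u ~ v → ¬ (degree u ≡ 2 × degree v ≡ 2)
      notBoth u~v (du≡2 , dv≡2) with covered u~v
      ... | inj₁ du≡Δ = case trans (sym du≡2) du≡Δ of λ ()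
      ... | inj₂ dv≡Δ = case trans (sym dv≡2) dv≡Δ of λ ()

  -- An interval of `Δ` consecutive integers starting at `e` cannot contain two multiples of `Δ`.
  quotient-≮ : ∀ c c′ {m m′ e} → m′ < Δ → m + e ≡ Δ * c → m′ + e ≡ Δ * c′ → ¬ c < c′
  quotient-≮ c c′ {m} {m′} {e} m′<Δ eq eq′ c<c′ = <-irrefl refl (begin-strict
    Δ * c′       ≡⟨ eq′ ⟨
    m′ + e       <⟨ +-monoˡ-< e m′<Δ ⟩
    Δ + e        ≤⟨ +-monoʳ-≤ Δ (m≤n+m e m) ⟩
    Δ + (m + e)  ≡⟨ cong (Δ +_) eq ⟩
    Δ + Δ * c    ≡⟨ *-suc Δ c ⟨
    Δ * suc c    ≤⟨ *-monoʳ-≤ Δ c<c′ ⟩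
    Δ * c′       ∎)
    where open ≤-Reasoning

  quotient-unique : ∀ c c′ {m m′ e} → m < Δ → m′ < Δ → m + e ≡ Δ * c → m′ + e ≡ Δ * c′ → c ≡ c′
  quotient-unique c c′ m<Δ m′<Δ eq eq′ =
    ≤-antisym (≮⇒≥ (quotient-≮ c′ c m<Δ eq′ eq)) (≮⇒≥ (quotient-≮ c c′ m′<Δ eq eq′))

  σ-unique : ∀ {n} (T T′ : Graph n) → Graph.IsTree T → Graph.IsTree T′ → IsΔCovered T → IsΔCovered T′ →
             Graph.m T Δ Δ < Δ → Graph.m T′ Δ Δ < Δ → Graph.σ T ≡ Graph.σ T′
  σ-unique {n} T T′ isTree isTree′ cov cov′ m<Δ m′<Δ =
    trans C.σ-formula (trans
      (cong₂ (λ x y → (2 + δ) ^ 2 * (1 * x) + (1 + δ) ^ 2 * (2 * y)) N₁≡ N₂≡)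
      (sym C′.σ-formula))
    where
    module C  = Counts T isTree cov
    module C′ = Counts T′ isTree′ cov′
    e  = length (Graph.edges T)
    e′ = length (Graph.edges T′)
    e≡ : e ≡ e′
    e≡ = +-cancelʳ-≡ 1 e e′ (trans C.1+∣edges∣≡n (sym C′.1+∣edges∣≡n))
    NΔ≡ : C.NΔ ≡ C′.NΔ
    NΔ≡ = quotient-unique C.NΔ C′.NΔ m<Δ m′<Δ C.mΔΔ+∣edges∣
      (trans (cong (Graph.m T′ Δ Δ +_) e≡) C′.mΔΔ+∣edges∣)
    N₁+N₂≡ : C.N₁ + C.N₂ ≡ C′.N₁ + C′.N₂
    N₁+N₂≡ = +-cancelʳ-≡ C.NΔ _ _ (trans C.numberOfVertices (trans (sym C′.numberOfVertices)
      (cong (C′.N₁ + C′.N₂ +_) (sym NΔ≡))))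
    N₁+2N₂≡ : 1 * C.N₁ + 2 * C.N₂ ≡ 1 * C′.N₁ + 2 * C′.N₂
    N₁+2N₂≡ = +-cancelʳ-≡ (Δ * C.NΔ) _ _ (trans C.degreeSum (trans (cong (2 *_) e≡)
      (trans (sym C′.degreeSum) (cong (λ x → 1 * C′.N₁ + 2 * C′.N₂ + Δ * x) (sym NΔ≡)))))
    -- Taking `N₁ + N₂` away from `N₁ + 2 N₂` isolates `N₂`.
    regroup : ∀ x y → 1 * x + 2 * y ≡ (x + y) + y
    regroup = solve 2 (λ x y → con 1 :* x :+ con 2 :* y := (x :+ y) :+ y) refl
    N₂≡ : C.N₂ ≡ C′.N₂
    N₂≡ = +-cancelˡ-≡ (C.N₁ + C.N₂) _ _ (trans (sym (regroup C.N₁ C.N₂))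
      (trans N₁+2N₂≡ (trans (regroup C′.N₁ C′.N₂) (cong (_+ C′.N₂) (sym N₁+N₂≡)))))
    N₁≡ : C.N₁ ≡ C′.N₁
    N₁≡ = +-cancelʳ-≡ C.N₂ _ _ (trans N₁+N₂≡ (cong (C′.N₁ +_) (sym N₂≡)))

-- Vertices of small degree and stars

module Degrees {n : ℕ} (G : Graph n) where
  open Graph G
  open Counting G

  private variable
    u v w x : Fin n

  degree≤maxDegree : ∀ v → degree v ≤ maxDegree
  degree≤maxDegree v = All.lookup (xs≤max 0 (map degree (allFin n))) (∈-map⁺ degree (∈-allFin v))

  maxDegree≤ : ∀ {k} → (∀ v → degree v ≤ k) → maxDegree ≤ k
  maxDegree≤ degree≤k = max≤v⁺ z≤n (All.map⁺ (All.universal degree≤k (allFin n)))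

  degree-1⇒neighbour-unique : degree u ≡ 1 → u ~ v → u ~ w → v ≡ w
  degree-1⇒neighbour-unique {v = v} {w} du≡1 u~v u~w with v Fin.≟ w
  ... | yes v≡w = v≡w
  ... | no v≢w  = contradiction
    (≤-trans (Unique⇒length≤degree ((v≢w ∷ []) ∷ [] ∷ []) (u~v ∷ u~w ∷ [])) (≤-reflexive du≡1)) λ { (s≤s ()) }

  degree-2⇒neighbours : degree v ≡ 2 → v ~ u → v ~ w → u ≢ w → v ~ x → x ≡ u ⊎ x ≡ w
  degree-2⇒neighbours {v} {u} {w} {x} dv≡2 v~u v~w u≢w v~x with x Fin.≟ u | x Fin.≟ w
  ... | yes x≡u | _       = inj₁ x≡u
  ... | _       | yes x≡w = inj₂ x≡w
  ... | no x≢u  | no x≢w  = contradiction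
    (≤-trans (Unique⇒length≤degree ((x≢u ∷ x≢w ∷ []) ∷ (u≢w ∷ []) ∷ [] ∷ []) (v~x ∷ v~u ∷ v~w ∷ []))
             (≤-reflexive dv≡2))
    λ { (s≤s (s≤s ())) }

  neighbour-unique⇒degree-1 : v ~ w → (∀ {x} → v ~ x → x ≡ w) → degree v ≡ 1
  neighbour-unique⇒degree-1 {v} v~w unique = trans (degree-∑ v) (∑-𝟙-unique (v ~?_) _ v~w λ _ → unique)

  -- When all neighbours of `v` are leaves, the closed star of `v` cannot be left: the only
  -- neighbour of such a leaf is `v` itself.
  star-closed : (∀ {x} → v ~ x → degree x ≡ 1) → x ≡ v ⊎ v ~ x → Star _~_ x w → w ≡ v ⊎ v ~ w
  star-closed leaves x∈star ε = x∈star
  star-closed leaves (inj₁ refl) (v~y ◅ walk) = star-closed leaves (inj₂ v~y) walk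
  star-closed leaves (inj₂ v~x)  (x~y ◅ walk) =
    star-closed leaves (inj₁ (degree-1⇒neighbour-unique (leaves v~x) x~y (~-sym v~x))) walk

  star⇒maxDegree : Connected → (∀ {x} → v ~ x → degree x ≡ 1) → 1 ≤ degree v → maxDegree ≤ degree v
  star⇒maxDegree {v} connected leaves 1≤dv = maxDegree≤ λ y → case star-closed leaves (inj₁ refl) (connected v y) of λ
    { (inj₁ refl) → ≤-refl
    ; (inj₂ v~y)  → ≤-trans (≤-reflexive (leaves v~y)) 1≤dv }

-- The family in terms of the covering condition

module _ (δ : ℕ) where
  open ΔCover δ

  In𝒯″⇒IsΔCovered : ∀ {n} (G : Graph n) → Graph.In𝒯″ G Δ → IsΔCovered G
  In𝒯″⇒IsΔCovered {n} G G∈𝒯″ = record { degree∈ = degree∈[1,2,Δ] ; covered = covered }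
    where
    open Graph G
    open In𝒯″ G∈𝒯″
    open IsTree isTree
    open Counting G
    open Degrees G

    -- Such a `v` would be the centre of a star filling the whole connected graph, with maximum
    -- degree less than `Δ`.
    not-star : ∀ {v d} → degree v ≡ d → 1 ≤ d → d < Δ → ¬ (∀ {x} → v ~ x → degree x ≡ 1)
    not-star {v} refl 1≤d d<Δ leaves =
      <⇒≱ d<Δ (subst (_≤ degree v) maxDegree≡Δ (star⇒maxDegree connected leaves 1≤d))

    leaf-neighbour : ∀ {u v} → degree u ≡ 1 → u ~ v → degree v ≡ Δ
    leaf-neighbour {u} {v} du≡1 u~v with degree∈[1,2,Δ] v
    ... | inj₂ (inj₂ dv≡Δ) = dv≡Δ
    ... | inj₁ dv≡1 = ⊥-elim (not-star dv≡1 ≤-refl (s≤s (s≤s z≤n))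
      λ v~x → subst (λ y → degree y ≡ 1) (degree-1⇒neighbour-unique dv≡1 (~-sym u~v) v~x) du≡1)
    ... | inj₂ (inj₁ dv≡2) with Fin.any? (λ x → (v ~? x) ×-dec (1 <? degree x))
    -- Here `v` has the two neighbours `u` and `x`, and only `x` is not a leaf, so `v` is an
    -- internal leaf.
    ...   | yes (x , v~x , 1<dx) = internalLeaf-degree v
      (≤-reflexive (sym dv≡2) , x , (v~x , 1<dx) , λ {y} (v~y , 1<dy) →
        case degree-2⇒neighbours dv≡2 (~-sym u~v) v~x (λ { refl → <-irrefl (sym du≡1) 1<dx }) v~y of λ
          { (inj₁ refl) → contradiction 1<dy (<-irrefl (sym du≡1))
          ; (inj₂ y≡x)  → sym y≡x })
    ...   | no none = ⊥-elim (not-star dv≡2 (s≤s z≤n) (s≤s (s≤s (s≤s z≤n))) only-leaves)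
      where
      only-leaves : ∀ {x} → v ~ x → degree x ≡ 1
      only-leaves {x} v~x with degree∈[1,2,Δ] x
      ... | inj₁ dx≡1         = dx≡1
      ... | inj₂ (inj₁ dx≡2) = contradiction (x , v~x , subst (1 <_) (sym dx≡2) ≤-refl) none
      ... | inj₂ (inj₂ dx≡Δ) = contradiction (x , v~x , subst (1 <_) (sym dx≡Δ) (s≤s (s≤s z≤n))) none

    covered : ∀ {u v} → u ~ v → degree u ≡ Δ ⊎ degree v ≡ Δ
    covered {u} {v} u~v with degree∈[1,2,Δ] u | degree∈[1,2,Δ] v
    ... | inj₂ (inj₂ du≡Δ) | _                  = inj₁ du≡Δ
    ... | _                | inj₂ (inj₂ dv≡Δ)   = inj₂ dv≡Δ
    ... | inj₁ du≡1        | _                  = inj₂ (leaf-neighbour du≡1 u~v)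
    ... | _                | inj₁ dv≡1          = inj₁ (leaf-neighbour dv≡1 (~-sym u~v))
    -- The one remaining pair of degrees is excluded by `m₂₂≡0`.
    ... | inj₂ (inj₁ du≡2) | inj₂ (inj₁ dv≡2)   =
      contradiction (subst (0 <_) (trans (cong₂ m du≡2 dv≡2) m₂₂≡0) (m>0 u~v)) n≮0

  IsΔCovered⇒In𝒯″ : ∀ {n} (G : Graph n) → Graph.IsTree G → IsΔCovered G →
                    (∃ λ c → Graph.degree G c ≡ Δ) → Graph.m G Δ Δ < Δ → Graph.In𝒯″ G Δ
  IsΔCovered⇒In𝒯″ {n} G isTree isΔCovered (c , dc≡Δ) (s≤s mΔΔ≤) = record
    { isTree              = isTree
    ; maxDegree≡Δ         = ≤-antisym (maxDegree≤ λ v → degree≤Δ (degree∈ v))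
                                      (subst (_≤ maxDegree) dc≡Δ (degree≤maxDegree c))
    ; internalLeaf-degree = internalLeaf
    ; degree∈[1,2,Δ]      = degree∈
    ; m₂₂≡0               = Counts.m₂₂≡0 G isTree isΔCovered
    ; mΔΔ≤Δ∸1             = mΔΔ≤
    }
    where
    open Graph G
    open IsΔCovered isΔCovered
    open Degrees G

    degree≤Δ : ∀ {d} → Deg∈ d → d ≤ Δ
    degree≤Δ (inj₁ refl)        = s≤s z≤n
    degree≤Δ (inj₂ (inj₁ refl)) = s≤s (s≤s z≤n)
    degree≤Δ (inj₂ (inj₂ refl)) = ≤-refl

    internalLeaf : ∀ v → InternalLeaf v → degree v ≡ Δ
    internalLeaf v (2≤dv , w , (v~w , 1<dw) , unique) with degree∈ v
    ... | inj₂ (inj₂ dv≡Δ) = dv≡Δ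
    ... | inj₁ dv≡1        = contradiction (subst (2 ≤_) dv≡1 2≤dv) λ { (s≤s ()) }
    -- By the covering, all neighbours of a vertex of degree 2 have degree `Δ`. If only `w` had
    -- degree above 1, it would be the sole neighbour of `v`.
    ... | inj₂ (inj₁ dv≡2) = contradiction (trans (sym dv≡2) (neighbour-unique⇒degree-1 v~w neighbour≡w)) λ ()
      where
      neighbour≡w : ∀ {x} → v ~ x → x ≡ w
      neighbour≡w v~x with covered v~x
      ... | inj₁ dv≡Δ = contradiction (trans (sym dv≡2) dv≡Δ) λ ()
      ... | inj₂ dx≡Δ = sym (unique (v~x , subst (1 <_) (sym dx≡Δ) (s≤s (s≤s z≤n))))

-- Acyclicity from a vertex ordering

module OneAbove {n : ℕ} (G : Graph n) where
  open Graph G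

  -- The numbering of a rooted forest in which the parent of a vertex is its only neighbour with a
  -- larger index.
  AtMostOneAbove : Set
  AtMostOneAbove = ∀ {x y z} → x ~ y → x ~ z → x Fin.< y → x Fin.< z → y ≡ z

  -- On a cycle a step down can only be followed by a step down, so from its base point the cycle rises and
  -- then falls. It cannot only rise or only fall, and otherwise the base point has two neighbours above it.
  module _ (oneAbove : AtMostOneAbove) where

    descending : ∀ {c x y} zs → x ~ y → y Fin.< x → All (c ≢_) (x ∷ y ∷ zs) → All (x ≢_) zs → Unique (y ∷ zs) →
                 Linked _~_ (y ∷ zs ++ [ c ]) → ∃ λ w → w ∈ (y ∷ zs) × w ~ c × c Fin.< w × w Fin.≤ y
    descending {c} {x} {y} [] x~y y<x (c≢x ∷ _) _ _ (y~c ∷ _) with Fin.<-cmp y c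
    ... | tri< y<c _ _ = contradiction (oneAbove y~c (~-sym x~y) y<c y<x) c≢x
    ... | tri≈ _ y≡c _ = contradiction y~c (~-irrefl y≡c)
    ... | tri> _ _ c<y = y , here refl , y~c , c<y , ≤-refl
    -- After the fall from `x` to `y`, a rise to `z` would give `y` the two upper neighbours `x` and
    -- `z`.
    descending {c} {x} {y} (z ∷ zs) x~y y<x (_ ∷ c∉) (x≢z ∷ _) (y∉ ∷ u) (y~z ∷ l) with Fin.<-cmp y z
    ... | tri< y<z _ _ = contradiction (oneAbove (~-sym x~y) y~z y<x y<z) x≢z
    ... | tri≈ _ y≡z _ = contradiction y~z (~-irrefl y≡z)
    ... | tri> _ _ z<y with descending zs y~z z<y c∉ (All.tail y∉) u l
    ...   | w , w∈ , w~c , c<w , w≤z = w , there w∈ , w~c , c<w , ≤-trans w≤z (<⇒≤ z<y)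

    ascending : ∀ {c y} zs → All (c ≢_) (y ∷ zs) → Unique (y ∷ zs) →
                Linked _~_ (y ∷ zs ++ [ c ]) → y Fin.< c ⊎ (∃ λ w → w ∈ (y ∷ zs) × w ~ c × c Fin.< w)
    ascending {c} {y} [] _ _ (y~c ∷ _) with Fin.<-cmp y c
    ... | tri< y<c _ _ = inj₁ y<c
    ... | tri≈ _ y≡c _ = contradiction y~c (~-irrefl y≡c)
    ... | tri> _ _ c<y = inj₂ (y , here refl , y~c , c<y)
    ascending {c} {y} (z ∷ zs) c∉@(_ ∷ c∉′) (y∉ ∷ u) (y~z ∷ l) with Fin.<-cmp y z
    ... | tri≈ _ y≡z _ = contradiction y~z (~-irrefl y≡z)
    ... | tri< y<z _ _ = Sum.map (<-trans y<z) (λ (w , w∈ , rest) → w , there w∈ , rest) (ascending zs c∉′ u l)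
    ... | tri> _ _ z<y with descending zs y~z z<y c∉ (All.tail y∉) u l
    ...   | w , w∈ , w~c , c<w , _ = inj₂ (w , there w∈ , w~c , c<w)

    AtMostOneAbove⇒Acyclic : Acyclic
    AtMostOneAbove⇒Acyclic v (y ∷ []) (s≤s () , _)
    AtMostOneAbove⇒Acyclic v (y ∷ z ∷ zs) (_ , v∉@(_ ∷ v≢z ∷ _) ∷ (y∉ ∷ u) , v~y ∷ y~z ∷ l) =
      conclude (Fin.<-cmp v y) (Fin.<-cmp y z)
      where
      conclude : _ → _ → ⊥
      conclude (tri≈ _ v≡y _) _ = ~-irrefl v≡y v~y
      conclude _ (tri≈ _ y≡z _) = ~-irrefl y≡z y~z
      conclude (tri> _ _ y<v) (tri< y<z _ _) = v≢z (oneAbove (~-sym v~y) y~z y<v y<z)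
      conclude (tri> _ _ y<v) (tri> _ _ z<y) with descending zs y~z z<y v∉ (All.tail y∉) u l
      ... | w , _ , _ , v<w , w≤z = <-irrefl refl (<-≤-trans v<w (≤-trans w≤z (<⇒≤ (<-trans z<y y<v))))
      -- Both the second vertex `y` and the last vertex `w` are neighbours above `v`, so they
      -- coincide, although `w` occurs after `y`.
      conclude (tri< v<y _ _) (tri> _ _ z<y) with descending zs y~z z<y v∉ (All.tail y∉) u l
      ... | w , w∈ , w~v , v<w , _ = All.lookup y∉ w∈ (oneAbove v~y (~-sym w~v) v<y v<w)
      conclude (tri< v<y _ _) (tri< y<z _ _) with ascending zs (All.tail v∉) u l
      ... | inj₁ z<v                    = <-asym z<v (<-trans v<y y<z)
      ... | inj₂ (w , w∈ , w~v , v<w) = All.lookup y∉ w∈ (oneAbove v~y (~-sym w~v) v<y v<w)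

-- Adding a leaf

module AddLeaf {n : ℕ} (G : Graph n) (w : Fin n) where
  open Graph G
  open OneAbove

  Adj : Fin (suc n) → Fin (suc n) → Set
  Adj zero    zero    = ⊥
  Adj zero    (suc v) = v ≡ w
  Adj (suc u) zero    = u ≡ w
  Adj (suc u) (suc v) = u ~ v

  adj? : ∀ u v → Dec (Adj u v)
  adj? zero    zero    = no λ ()
  adj? zero    (suc v) = v Fin.≟ w
  adj? (suc u) zero    = u Fin.≟ w
  adj? (suc u) (suc v) = u ~? v

  Adj-sym : ∀ u v → Adj u v → Adj v u
  Adj-sym zero    (suc v) v≡w = v≡w
  Adj-sym (suc u) zero    u≡w = u≡w
  Adj-sym (suc u) (suc v) u~v = ~-sym u~v

  Adj-irrefl : ∀ u → ¬ Adj u u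
  Adj-irrefl (suc u) u~u = ~-irrefl refl u~u

  addLeaf : Graph (suc n)
  addLeaf = record
    { _~_      = Adj
    ; _~?_     = adj?
    ; ~-sym    = λ {u} {v} → Adj-sym u v
    ; ~-irrefl = λ { {u} refl → Adj-irrefl u }
    }

  private module G⁺ = Graph addLeaf

  degree-leaf : G⁺.degree zero ≡ 1
  degree-leaf = trans (Counting.degree-∑ addLeaf zero) (∑-𝟙≟ w)

  degree-old : ∀ u → G⁺.degree (suc u) ≡ 𝟙 (u Fin.≟ w) + degree u
  degree-old u = trans (Counting.degree-∑ addLeaf (suc u)) (cong (𝟙 (u Fin.≟ w) +_) (sym (Counting.degree-∑ G u)))

  connected⁺ : Connected → G⁺.Connected
  connected⁺ connected = λ
    { zero    zero    → ε
    ; zero    (suc v) → refl ◅ lift w v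
    ; (suc u) zero    → lift u w ◅◅ (refl ◅ ε)
    ; (suc u) (suc v) → lift u v }
    where
    lift : ∀ u v → Star Adj (suc u) (suc v)
    lift u v = gmap suc id (connected u v)

  -- The new vertex has the least index, so `w` is its only neighbour above, and the old vertices
  -- gain no neighbour above them.
  oneAbove⁺ : AtMostOneAbove G → AtMostOneAbove addLeaf
  oneAbove⁺ oneAbove {zero}  {suc y} {suc z} y≡w z≡w _ _ = cong suc (trans y≡w (sym z≡w))
  oneAbove⁺ oneAbove {suc x} {suc y} {suc z} x~y x~z (s≤s x<y) (s≤s x<z) = cong suc (oneAbove x~y x~z x<y x<z)

-- Construction of a tree in the family

module Construction (δ : ℕ) where
  open ΔCover δ

  -- A tree in which the vertex w, of current degree e, is still receiving leaves; target is the final degree.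
  record Growing (n e c t : ℕ) : Set₁ where
    field
      G         : Graph n
    open Graph G
    field
      connected : Connected
      oneAbove  : OneAbove.AtMostOneAbove G
      w         : Fin n
      target    : Fin n → ℕ
      target∈   : ∀ u → Deg∈ (target u)
      covered   : ∀ {u v} → u ~ v → target u ≡ Δ ⊎ target v ≡ Δ
      complete  : ∀ {u} → u ≢ w → degree u ≡ target u
      degree-w  : degree w ≡ e
      target-w  : target w ≡ t
      ∑-target  : ∑ (λ u → 𝟙 (target u ≟ Δ)) ≡ c

  private variable
    e c t : ℕ

  seed : Growing 1 0 1 Δ
  seed = record
    { G         = record { _~_ = λ _ _ → ⊥ ; _~?_ = λ _ _ → no id ; ~-sym = id ; ~-irrefl = λ _ () }
    ; connected = λ { zero zero → ε }
    ; oneAbove  = λ ()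
    ; w         = zero
    ; target    = λ _ → Δ
    ; target∈   = λ _ → inj₂ (inj₂ refl)
    ; covered   = λ ()
    ; complete  = λ { {zero} z≢z → contradiction refl z≢z }
    ; degree-w  = refl
    ; target-w  = refl
    ; ∑-target  = cong (_+ 0) (𝟙-yes (Δ ≟ Δ) refl)
    }

  module _ (S : Growing n e c t) where
    open Growing S
    open AddLeaf G w

    private
      target⁺ : ℕ → Fin (suc n) → ℕ
      target⁺ t′ zero    = t′
      target⁺ t′ (suc u) = target u

      target⁺∈ : ∀ {t′} → Deg∈ t′ → ∀ u → Deg∈ (target⁺ t′ u)
      target⁺∈ t′∈ zero    = t′∈
      target⁺∈ t′∈ (suc u) = target∈ u

      covered⁺ : ∀ {t′} → t ≡ Δ ⊎ t′ ≡ Δ → ∀ u v → Adj u v → target⁺ t′ u ≡ Δ ⊎ target⁺ t′ v ≡ Δ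
      covered⁺ cov zero    (suc v) refl = Sum.swap (Sum.map₁ (trans target-w) cov)
      covered⁺ cov (suc u) zero    refl = Sum.map₁ (trans target-w) cov
      covered⁺ cov (suc u) (suc v) u~v  = covered u~v

      degree-other : ∀ {u} → u ≢ w → Graph.degree addLeaf (suc u) ≡ target u
      degree-other {u} u≢w =
        trans (degree-old u) (trans (cong (_+ Graph.degree G u) (𝟙-no (u Fin.≟ w) u≢w)) (complete u≢w))

      degree-w⁺ : Graph.degree addLeaf (suc w) ≡ suc e
      degree-w⁺ = trans (degree-old w) (cong₂ _+_ (𝟙-yes (w Fin.≟ w) refl) degree-w)

    attachLeaf : t ≡ Δ → Growing (suc n) (suc e) c t
    attachLeaf t≡Δ = record
      { G         = addLeaf
      ; connected = connected⁺ connected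
      ; oneAbove  = λ {x} → oneAbove⁺ oneAbove {x}
      ; w         = suc w
      ; target    = target⁺ 1
      ; target∈   = target⁺∈ (inj₁ refl)
      ; covered   = λ {u} {v} → covered⁺ (inj₁ t≡Δ) u v
      ; complete  = λ { {zero} _ → degree-leaf ; {suc u} u≢w → degree-other (u≢w ∘ cong suc) }
      ; degree-w  = degree-w⁺
      ; target-w  = target-w
      ; ∑-target  = ∑-target
      }

    -- The new vertex takes over the role of `w`, so this edge must be the last one that the old `w`
    -- receives.
    attachNext : ∀ {t′} → suc e ≡ t → Deg∈ t′ → t ≡ Δ ⊎ t′ ≡ Δ → Growing (suc n) 1 (𝟙 (t′ ≟ Δ) + c) t′
    attachNext {t′} 1+e≡t t′∈ cov = record
      { G         = addLeaf
      ; connected = connected⁺ connected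
      ; oneAbove  = λ {x} → oneAbove⁺ oneAbove {x}
      ; w         = zero
      ; target    = target⁺ t′
      ; target∈   = target⁺∈ t′∈
      ; covered   = λ {u} {v} → covered⁺ cov u v
      ; complete  = λ { {zero} z≢z → contradiction refl z≢z ; {suc u} _ → old u }
      ; degree-w  = degree-leaf
      ; target-w  = refl
      ; ∑-target  = cong (𝟙 (t′ ≟ Δ) +_) ∑-target
      }
      where
      old : ∀ u → Graph.degree addLeaf (suc u) ≡ target u
      old u = case u Fin.≟ w of λ
        { (yes refl) → trans degree-w⁺ (trans 1+e≡t (sym target-w))
        ; (no u≢w)   → degree-other u≢w }

  attachLeaves : ∀ i → Growing n e c Δ → Growing (i + n) (i + e) c Δ
  attachLeaves zero    S = S
  attachLeaves (suc i) S = attachLeaf (attachLeaves i S) refl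

  -- Leaves are added up to degree `Δ ∸ 1`; the last edge is reserved for the next vertex of the
  -- path.
  fill : Growing n 1 c Δ → Growing (suc δ + n) (2 + δ) c Δ
  fill {n} {c} S = subst (λ e → Growing (suc δ + n) e c Δ) (+-comm (suc δ) 1) (attachLeaves (suc δ) S)

  attachΔ : Growing n e c t → suc e ≡ t → Growing (suc n) 1 (suc c) Δ
  attachΔ {n} {c = c} S 1+e≡t =
    subst (λ x → Growing (suc n) 1 x Δ) (cong (_+ c) (𝟙-yes (Δ ≟ Δ) refl))
      (attachNext S 1+e≡t (inj₂ (inj₂ refl)) (inj₂ refl))

  extend : Growing n (2 + δ) c Δ → Growing (suc δ + (1 + n)) (2 + δ) (suc c) Δ
  extend S = fill (attachΔ S refl)

  extendVia2 : Growing n (2 + δ) c Δ → Growing (suc δ + (2 + n)) (2 + δ) (suc c) Δ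
  extendVia2 S = fill (attachΔ (attachNext S refl (inj₂ (inj₁ refl)) (inj₁ refl)) refl)

  -- The first vertex brings `Δ ∸ 2` leaves and one more for its missing predecessor, `3 + δ`
  -- vertices in all. Each of the `a` direct joins adds `2 + δ` vertices, and each of the `b` joins
  -- through a vertex of degree 2 adds `3 + δ`. The last vertex of the path still lacks one edge.
  chain : ∀ a b → Growing (a * (2 + δ) + (b * (3 + δ) + (3 + δ))) (2 + δ) (1 + (a + b)) Δ
  chain zero zero = subst₂ (λ n e → Growing n e 1 Δ) (+-comm (2 + δ) 1) (+-identityʳ (2 + δ))
    (attachLeaves (2 + δ) seed)
  chain zero (suc b) = subst (λ n → Growing n (2 + δ) (2 + b) Δ)
    (solve 2 (λ d x → con 1 :+ d :+ (con 2 :+ (x :+ (con 3 :+ d))) := con 3 :+ d :+ x :+ (con 3 :+ d))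
      refl δ (b * (3 + δ)))
    (extendVia2 (chain zero b))
  chain (suc a) b = subst (λ n → Growing n (2 + δ) (2 + (a + b)) Δ)
    (solve 3 (λ d x y → con 1 :+ d :+ (con 1 :+ (x :+ y)) := con 2 :+ d :+ x :+ y)
      refl δ (a * (2 + δ)) (b * (3 + δ) + (3 + δ)))
    (extend (chain a b))

  -- The value of `m Δ Δ` follows from the counting identities, with no inspection of the tree:
  -- there are `1 + k` vertices of degree `Δ` and `k * Δ + j` edges, which gives `m Δ Δ + j ≡ Δ`,
  -- and `j` is positive.
  Growing⇒In𝒯″ : ∀ {k j} → 1 ≤ j → n ≡ k * Δ + 1 + j → Growing n Δ (1 + k) Δ →
                    ∃ λ (T : Graph n) → Graph.In𝒯″ T Δ
  Growing⇒In𝒯″ {n = n} {k} {j} 1≤j n≡ S =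
    G , IsΔCovered⇒In𝒯″ δ G isTree isΔCovered (w , degree-w) mΔΔ<Δ
    where
    open Growing S
    open Graph G
    degree≡target : ∀ u → degree u ≡ target u
    degree≡target u = case u Fin.≟ w of λ
      { (yes refl) → trans degree-w (sym target-w)
      ; (no u≢w)   → complete u≢w }
    isTree : IsTree
    isTree = record
      { nonEmpty  = Fin.nonZeroIndex w
      ; connected = connected
      ; acyclic   = OneAbove.AtMostOneAbove⇒Acyclic G oneAbove }
    isΔCovered : IsΔCovered G
    isΔCovered = record
      { degree∈ = λ u → subst Deg∈ (sym (degree≡target u)) (target∈ u)
      ; covered = λ {u} {v} u~v → Sum.map (trans (degree≡target u)) (trans (degree≡target v)) (covered u~v) }
    open Counts G isTree isΔCovered
    open ≡-Reasoning
    NΔ≡ : NΔ ≡ 1 + k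
    NΔ≡ = trans (sum-cong-≗ λ u → cong (λ d → 𝟙 (d ≟ Δ)) (degree≡target u)) ∑-target
    ∣edges∣ : length edges ≡ k * Δ + j
    ∣edges∣ = +-cancelʳ-≡ 1 _ _ (begin
      length edges + 1 ≡⟨ 1+∣edges∣≡n ⟩
      n                ≡⟨ n≡ ⟩
      k * Δ + 1 + j    ≡⟨ +-assoc (k * Δ) 1 j ⟩
      k * Δ + (1 + j)  ≡⟨ cong (k * Δ +_) (+-comm 1 j) ⟩
      k * Δ + (j + 1)  ≡⟨ +-assoc (k * Δ) j 1 ⟨
      k * Δ + j + 1    ∎)
    mΔΔ+j≡Δ : m Δ Δ + j ≡ Δ
    mΔΔ+j≡Δ = +-cancelˡ-≡ (k * Δ) _ _ (begin
      k * Δ + (m Δ Δ + j)   ≡⟨ solve 3 (λ x y z → x :+ (y :+ z) := y :+ (x :+ z)) refl (k * Δ) (m Δ Δ) j ⟩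
      m Δ Δ + (k * Δ + j)   ≡⟨ cong (m Δ Δ +_) ∣edges∣ ⟨
      m Δ Δ + length edges  ≡⟨ mΔΔ+∣edges∣ ⟩
      Δ * NΔ                ≡⟨ cong (Δ *_) NΔ≡ ⟩
      Δ * (1 + k)           ≡⟨ *-comm Δ (1 + k) ⟩
      Δ + k * Δ             ≡⟨ +-comm Δ (k * Δ) ⟩
      k * Δ + Δ             ∎)
    mΔΔ<Δ : m Δ Δ < Δ
    mΔΔ<Δ = subst (m Δ Δ <_) mΔΔ+j≡Δ (m<m+n (m Δ Δ) 1≤j)

  chain-size : ∀ a b j → a + j ≡ Δ → suc (a * (2 + δ) + (b * (3 + δ) + (3 + δ))) ≡ (a + b) * Δ + 1 + j
  chain-size a b j a+j≡Δ = begin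
    suc (a * (2 + δ) + (b * Δ + Δ))
      -- Only the `Δ` contributed by the first vertex is rewritten as `a + j`; the equation then
      -- becomes a polynomial identity.
      ≡⟨ cong (λ x → suc (a * (2 + δ) + (b * Δ + x))) a+j≡Δ ⟨
    suc (a * (2 + δ) + (b * Δ + (a + j)))
      ≡⟨ solve 4 (λ d a b j → con 1 :+ (a :* (con 2 :+ d) :+ (b :* (con 3 :+ d) :+ (a :+ j)))
                            := (a :+ b) :* (con 3 :+ d) :+ con 1 :+ j) refl δ a b j ⟩
    (a + b) * Δ + 1 + j ∎
    where open ≡-Reasoning

  In𝒯″-nonempty : ∀ {n} k j → n ≡ k * Δ + 1 + j → Δ ∸ 1 ≤ k → 1 ≤ j → j ≤ Δ ∸ 1 →
                  ∃ λ (T : Graph n) → Graph.In𝒯″ T Δ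
  In𝒯″-nonempty {n} k j n≡ Δ-1≤k 1≤j j≤Δ-1 = Growing⇒In𝒯″ 1≤j n≡
    -- The last vertex of the path has no successor, so one more leaf completes its degree.
    (subst₂ (λ n k → Growing n Δ (1 + k) Δ) size a+b≡k (attachLeaf (chain a b) refl))
    where
    -- The relation `m Δ Δ + j ≡ Δ` dictates the number of direct joins. The other joins of the
    -- `1 + k` path vertices go through a vertex of degree 2.
    a = Δ ∸ j
    b = k ∸ a
    a≤k : a ≤ k
    a≤k = ≤-trans (∸-monoʳ-≤ Δ 1≤j) Δ-1≤k
    a+b≡k : a + b ≡ k
    a+b≡k = m+[n∸m]≡n a≤k
    size : suc (a * (2 + δ) + (b * (3 + δ) + (3 + δ))) ≡ n
    size = trans (chain-size a b j (m∸n+n≡m (≤-trans j≤Δ-1 (n≤1+n _))))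
      (trans (cong (λ x → x * Δ + 1 + j) a+b≡k) (sym n≡))

open Graph using (σ; In𝒯″)

proposition6 : (Δ n k j : ℕ) → 6 ≤ Δ → n ≡ k * Δ + 1 + j → Δ ∸ 1 ≤ k → 1 ≤ j → j ≤ Δ ∸ 1 →
    (∃ λ (T : Graph n) → In𝒯″ T Δ) ×
    ((T T′ : Graph n) → In𝒯″ T Δ → In𝒯″ T′ Δ → σ T ≡ σ T′)
proposition6 (suc (suc (suc δ))) n k j (s≤s (s≤s (s≤s _))) n≡ Δ-1≤k 1≤j j≤Δ-1 =
  Construction.In𝒯″-nonempty δ k j n≡ Δ-1≤k 1≤j j≤Δ-1 ,
  λ T T′ T∈𝒯″ T′∈𝒯″ → ΔCover.σ-unique δ T T′ (isTree T∈𝒯″) (isTree T′∈𝒯″)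
    -- With `Δ` written as `3 + δ`, `Δ ∸ 1` computes to `2 + δ`, and `s≤s` turns the bound in the
    -- family into `m Δ Δ < Δ`.
    (In𝒯″⇒IsΔCovered δ T T∈𝒯″) (In𝒯″⇒IsΔCovered δ T′ T′∈𝒯″) (s≤s (mΔΔ≤Δ∸1 T∈𝒯″)) (s≤s (mΔΔ≤Δ∸1 T′∈𝒯″))
  where open In𝒯″
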